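{- Let $\mathbb F=([0,1],\max,\min,0,1)$ be the fuzzy semiring. For every satisfiable $\mathbb F$-annotated $\mathcal{ELHI}^n_\bot$ ontology $\mathcal O^{\mathbb F}=\langle\mathcal O,\lambda\rangle$ and $n\in[0,1]$, $$\mathcal P(\alpha,\mathcal O^{\mathbb F})\geq n\quad\text{iff}\quad\mathcal O_{\geq n}\models\alpha$$ holds if: (1) $\alpha$ is a BCQ, an assertion, or an RI whose left-hand side is satisfiable w.r.t. $\mathcal O$; or (2) $\alpha$ is a GCI between basic concepts whose left-hand side is satisfiable w.r.t. $\mathcal O$ and $\mathcal O$ does not contain any GCI with $\top$ as left-hand side.
   Context: Syntax. Let $\mathsf{N_C},\mathsf{N_R},\mathsf{N_I}$ be mutually disjoint countable sets of concept, role and individual names. A role $P$ is a role name $R\in\mathsf{N_R}$ or an inverse role $R^-$. Concepts: $C::=A\mid\exists P.C\mid C\sqcap C\mid\top$ ($A\in\mathsf{N_C}$); $\exists P$ abbreviates $\exists P.\top$; basic concepts are those of the form $A$ or $\exists P$. $\mathcal{ELHI}^n_\bot$ axioms (the superscript $n$ in the name stands for "normalized" and is unrelated to the number $n$ in the claim): assertions $A(a)$, $R(a,b)$; general concept inclusions (GCIs) $C\sqsubseteq D$ with $C::=A\mid\exists P.C\mid C\sqcap C\mid\top$ and $D::=A\mid\exists P.\top\mid\bot$; role inclusions (RIs) $P\sqsubseteq Q$ (positive) and $P\sqcap Q\sqsubseteq\bot$ (negative). An ontology is a finite set of axioms. A BCQ (Boolean conjunctive query) is $\exists\vec y\,\phi(\vec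 y)$ with $\phi$ a conjunction of atoms $A(t)$, $R(t,t')$, terms in $\mathsf{N_I}\cup\vec y$. Classical interpretations, models, satisfaction and entailment $\models$ are the usual (first-order) ones for description logics. The left-hand side $E$ of an inclusion is satisfiable w.r.t. $\mathcal O$ if $E^{\mathcal I}\neq\emptyset$ for some model $\mathcal I$ of $\mathcal O$. Annotated semantics (for a commutative semiring $\mathbb K=(K,\oplus,\otimes,\mathbf 0,\mathbf 1)$; here $\mathbb K=\mathbb F$). A $\mathbb K$-annotated ontology is a pair $\langle\mathcal O,\lambda\rangle$ with $\lambda:\mathcal O\to K\setminus\{\mathbf 0\}$, identified with the set of annotated axioms $(\alpha,\lambda(\alpha))$. A $\mathbb K$-annotated interpretation $\mathcal I$ has a nonempty domain $\Delta^{\mathcal I}$ and maps $a\in\mathsf{N_I}$ to $a^{\mathcal I}\in\Delta^{\mathcal I}$, $A\in\mathsf{N_C}$ to $A^{\mathcal I}\subseteq\Delta^{\mathcal I}\times K$, $R\in\mathsf{N_R}$ to $R^{\mathcal I}\subseteq\Delta^{\mathcal I}\times\Delta^{\mathcal I}\times K$, with $\top^{\mathcal I}=\Delta^{\mathcal I}\times\{\mathbf 1\}$, $\bot^{\mathcal I}=\emptyset$, $(R^-)^{\mathcal I}=\{(e,d,\kappa)\mid(d,e,\kappa)\in R^{\mathcal I}\}$, $(\exists P.C)^{\mathcal I}=\{(d,\kappa\otimes\kappa')\mid\exists e:(d,e,\kappa)\in P^{\mathcal I},(e,\kappa')\in C^{\mathcal I}\}$, $(C\sqcap D)^{\mathcal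 I}=\{(d,\kappa\otimes\kappa')\mid(d,\kappa)\in C^{\mathcal I},(d,\kappa')\in D^{\mathcal I}\}$, $(P\sqcap Q)^{\mathcal I}=\{(d,e,\kappa\otimes\kappa')\mid(d,e,\kappa)\in P^{\mathcal I},(d,e,\kappa')\in Q^{\mathcal I}\}$. $\mathcal I$ satisfies $(C\sqsubseteq D,\kappa)$ if $(d,\kappa')\in C^{\mathcal I}$ implies $(d,\kappa\otimes\kappa')\in D^{\mathcal I}$; $(P\sqsubseteq Q,\kappa)$ if $(d,e,\kappa')\in P^{\mathcal I}$ implies $(d,e,\kappa\otimes\kappa')\in Q^{\mathcal I}$; $(P\sqcap Q\sqsubseteq\bot,\kappa)$ if $(P\sqcap Q)^{\mathcal I}=\emptyset$; $(A(a),\kappa)$ if $(a^{\mathcal I},\kappa)\in A^{\mathcal I}$; $(R(a,b),\kappa)$ if $(a^{\mathcal I},b^{\mathcal I},\kappa)\in R^{\mathcal I}$. $\mathcal I\models(q,\kappa)$ for a BCQ $q$ if there are a map $\pi$ from the terms of $q$ to $\Delta^{\mathcal I}$ with $\pi(c)=c^{\mathcal I}$ for $c\in\mathsf{N_I}$ and, for each atom occurrence $E(\vec t)$ of $q$, some $\kappa_{E(\vec t)}\in K$ with $(\pi(\vec t),\kappa_{E(\vec t)})\in E^{\mathcal I}$, such that $\kappa$ is the $\otimes$-product of all these elements. Models satisfy all annotated axioms; $\mathcal O^{\mathbb K}$ is satisfiable if it has a model; $\mathcal O^{\mathbb K}\models(\alpha,\kappa)$ if every model satisfies $(\alpha,\kappa)$.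 Provenance. $\mathcal P(\alpha,\mathcal O^{\mathbb K})=\bigoplus_{\kappa:\ \mathcal O^{\mathbb K}\models(\alpha,\kappa)}\kappa$; for $\mathbb F$ this is $\sup\{n'\in[0,1]\mid\mathcal O^{\mathbb F}\models(\alpha,n')\}$, with value $0$ for the empty set. $n$-cut: $\mathcal O_{\geq n}=\{\beta\in\mathcal O\mid\lambda(\beta)\geq n\}$.
   Formalization: n = 0 is excluded, since there the claim fails (O empty, α = A(a)), and in (2) O may also contain no GCI whose left-hand side is a conjunction of ⊤'s such as ⊤⊓⊤, since O = {(⊤⊓⊤ ⊑ A, 1)}, α = B ⊑ A, n = 1 refutes the literal claim. -}

module Defs where

open import Algebra.Bundles using (CommutativeSemiring)
open import Axiom.ExcludedMiddle using (ExcludedMiddle)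
open import Data.Bool using (Bool; true; false; T; _∧_; _∨_)
open import Data.Bool.Properties using
  ( ∨-assoc; ∨-comm; ∧-assoc; ∧-comm
  ; ∧-distribˡ-∨; ∧-distribʳ-∨; T-∧; T-∨ )
open import Data.Empty using (⊥; ⊥-elim)
open import Data.Fin using (Fin)
open import Data.List using (List; foldr)
open import Data.List.Membership.Propositional using (_∈_)
open import Data.List.Relation.Binary.Pointwise using (Pointwise)
open import Data.List.Relation.Unary.All using (All)
open import Data.Nat using (ℕ)
open import Data.Product using (∃-syntax; Σ-syntax; _×_; _,_; proj₁; proj₂)
open import Data.Rational using (ℚ; 0ℚ; 1ℚ)
import Data.Rational as ℚ
import Data.Rational.Properties as ℚₚ
open import Data.Sum using (_⊎_; inj₁; inj₂; [_,_]′)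
open import Data.Unit using (⊤; tt)
open import Function using (Equivalence; _↣_)
open import Level using (0ℓ) renaming (suc to lsuc)
open import Relation.Binary.Definitions using (tri<; tri≈; tri>)
open import Relation.Binary.PropositionalEquality
  using (_≡_; refl; sym; trans; cong₂; subst)
open import Relation.Nullary using (¬_)
open import Relation.Nullary.Decidable using (⌊_⌋; toWitness; fromWitness)
open import Relation.Unary using (Pred)

------------------------------------------------------------------------
-- The real interval [0,1]

-- Dedekind cuts given by their lower halves, ordered by inclusion.  The
-- results are read classically (excluded middle is an explicit hypothesis
-- where it is used), so a set of rationals is its characteristic function.

record ℝ : Set where
  field
    lower     : ℚ → Bool
    inhabited : ∃[ q ] T (lower q)
    proper    : ∃[ q ] ¬ T (lower q)
    closed    : ∀ {p q} → p ℚ.< q → T (lower q) → T (lower p)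
    rounded   : ∀ {q} → T (lower q) → ∃[ r ] (q ℚ.< r × T (lower r))

open ℝ public

infix 4 _≤ℝ_
_≤ℝ_ : ℝ → ℝ → Set
x ≤ℝ y = ∀ q → T (lower x q) → T (lower y q)

fromℚ : ℚ → ℝ
fromℚ r = record
  { lower     = λ q → ⌊ q ℚ.<? r ⌋
  ; inhabited = r ℚ.- 1ℚ , fromWitness below
  ; proper    = r , λ t → ℚₚ.<-irrefl refl (toWitness t)
  ; closed    = λ p<q t → fromWitness (ℚₚ.<-trans p<q (toWitness t))
  ; rounded   = λ t → let (m , q<m , m<r) = ℚₚ.<-dense (toWitness t)
                      in m , q<m , fromWitness m<r
  }
  where
  below : r ℚ.- 1ℚ ℚ.< r
  below = subst (r ℚ.- 1ℚ ℚ.<_) (ℚₚ.+-identityʳ r)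
            (ℚₚ.+-monoʳ-< r (ℚₚ.negative⁻¹ (ℚ.- 1ℚ)))

private
  T∧ : ∀ {a b} → T a → T b → T (a ∧ b)
  T∧ s t = Equivalence.from T-∧ (s , t)

  T∧⁻ : ∀ {a b} → T (a ∧ b) → T a × T b
  T∧⁻ = Equivalence.to T-∧

  T∨⁻ : ∀ {a b} → T (a ∨ b) → T a ⊎ T b
  T∨⁻ = Equivalence.to T-∨

  T∨ˡ : ∀ {a b} → T a → T (a ∨ b)
  T∨ˡ t = Equivalence.from T-∨ (inj₁ t)

  T∨ʳ : ∀ {a b} → T b → T (a ∨ b)
  T∨ʳ t = Equivalence.from T-∨ (inj₂ t)

maxℝ : ℝ → ℝ → ℝ
maxℝ x y = record
  { lower     = λ q → lower x q ∨ lower y q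
  ; inhabited = let (q , t) = inhabited x in q , T∨ˡ t
  ; proper    = prop
  ; closed    = λ p<q t → [ (λ s → T∨ˡ (closed x p<q s))
                          , (λ s → T∨ʳ (closed y p<q s)) ]′ (T∨⁻ t)
  ; rounded   = λ t → [ (λ s → let (r , q<r , u) = rounded x s in r , q<r , T∨ˡ u)
                      , (λ s → let (r , q<r , u) = rounded y s in r , q<r , T∨ʳ u)
                      ]′ (T∨⁻ t)
  }
  where
  prop : ∃[ q ] ¬ T (lower x q ∨ lower y q)
  prop with proper x | proper y
  ... | p , ¬p | q , ¬q with ℚₚ.<-cmp p q
  ...   | tri< p<q _ _ = q , λ t → [ (λ s → ¬p (closed x p<q s)) , ¬q ]′ (T∨⁻ t)
  ...   | tri≈ _ refl _ = q , λ t → [ ¬p , ¬q ]′ (T∨⁻ t)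
  ...   | tri> _ _ q<p = p , λ t → [ ¬p , (λ s → ¬q (closed y q<p s)) ]′ (T∨⁻ t)

minℝ : ℝ → ℝ → ℝ
minℝ x y = record
  { lower     = λ q → lower x q ∧ lower y q
  ; inhabited = inh
  ; proper    = let (q , ¬q) = proper x in q , λ t → ¬q (proj₁ (T∧⁻ t))
  ; closed    = λ p<q t → let (s , u) = T∧⁻ t in T∧ (closed x p<q s) (closed y p<q u)
  ; rounded   = rnd
  }
  where
  inh : ∃[ q ] T (lower x q ∧ lower y q)
  inh with inhabited x | inhabited y
  ... | p , s | q , t with ℚₚ.<-cmp p q
  ...   | tri< p<q _ _ = p , T∧ s (closed y p<q t)
  ...   | tri≈ _ refl _ = p , T∧ s t
  ...   | tri> _ _ q<p = q , T∧ (closed x q<p s) t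

  rnd : ∀ {q} → T (lower x q ∧ lower y q) → ∃[ r ] (q ℚ.< r × T (lower x r ∧ lower y r))
  rnd t with rounded x (proj₁ (T∧⁻ t)) | rounded y (proj₂ (T∧⁻ {lower x _} t))
  ... | p , q<p , s | r , q<r , u with ℚₚ.<-cmp p r
  ...   | tri< p<r _ _ = p , q<p , T∧ s (closed y p<r u)
  ...   | tri≈ _ refl _ = p , q<p , T∧ s u
  ...   | tri> _ _ r<p = r , q<r , T∧ (closed x r<p s) u

record 𝕀 : Set where
  constructor mk𝕀
  field
    value : ℝ
    0≤    : fromℚ 0ℚ ≤ℝ value
    ≤1    : value ≤ℝ fromℚ 1ℚ

open 𝕀 public

infix 4 _≤_ _≈_
_≤_ : 𝕀 → 𝕀 → Set
x ≤ y = value x ≤ℝ value y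

_≈_ : 𝕀 → 𝕀 → Set
x ≈ y = ∀ q → lower (value x) q ≡ lower (value y) q

0𝕀 1𝕀 : 𝕀
0𝕀 = mk𝕀 (fromℚ 0ℚ) (λ _ t → t)
  (λ q t → fromWitness (ℚₚ.<-trans {q} (toWitness t) (ℚₚ.positive⁻¹ 1ℚ)))
1𝕀 = mk𝕀 (fromℚ 1ℚ)
  (λ q t → fromWitness (ℚₚ.<-trans {q} (toWitness t) (ℚₚ.positive⁻¹ 1ℚ)))
  (λ _ t → t)

max min : 𝕀 → 𝕀 → 𝕀
max x y = mk𝕀 (maxℝ (value x) (value y))
  (λ q t → T∨ˡ (0≤ x q t))
  (λ q t → [ ≤1 x q , ≤1 y q ]′ (T∨⁻ t))
min x y = mk𝕀 (minℝ (value x) (value y))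
  (λ q t → T∧ (0≤ x q t) (0≤ y q t))
  (λ q t → ≤1 x q (proj₁ (T∧⁻ t)))

private
  absorb∨ : ∀ {a b} → (T a → T b) → a ∨ b ≡ b
  absorb∨ {false}         _ = refl
  absorb∨ {true}  {true}  _ = refl
  absorb∨ {true}  {false} f = ⊥-elim (f tt)

  absorb∧ : ∀ {a b} → (T a → T b) → a ∧ b ≡ a
  absorb∧ {false}         _ = refl
  absorb∧ {true}  {true}  _ = refl
  absorb∧ {true}  {false} f = ⊥-elim (f tt)

  max-identityˡ : ∀ x → max 0𝕀 x ≈ x
  max-identityˡ x q = absorb∨ (0≤ x q)

  min-identityʳ : ∀ x → min x 1𝕀 ≈ x
  min-identityʳ x q = absorb∧ (≤1 x q)

  min-zeroˡ : ∀ x → min 0𝕀 x ≈ 0𝕀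
  min-zeroˡ x q = absorb∧ (0≤ x q)

𝔽 : CommutativeSemiring 0ℓ 0ℓ
𝔽 = record
  { Carrier = 𝕀
  ; _≈_ = _≈_
  ; _+_ = max
  ; _*_ = min
  ; 0# = 0𝕀
  ; 1# = 1𝕀
  ; isCommutativeSemiring = record
    { isSemiring = record
      { isSemiringWithoutAnnihilatingZero = record
        { +-isCommutativeMonoid = record
          { isMonoid = record
            { isSemigroup = record
              { isMagma = record
                { isEquivalence = record
                  { refl = λ _ → refl
                  ; sym = λ e q → sym (e q)
                  ; trans = λ e f q → trans (e q) (f q)
                  }
                ; ∙-cong = λ e f q → cong₂ _∨_ (e q) (f q)
                }
              ; assoc = λ x y z q →
                  ∨-assoc (lower (value x) q) (lower (value y) q) (lower (value z) q)
              }
            ; identity = max-identityˡ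
                       , λ x q → trans (∨-comm (lower (value x) q) _) (max-identityˡ x q)
            }
          ; comm = λ x y q → ∨-comm (lower (value x) q) (lower (value y) q)
          }
        ; *-cong = λ e f q → cong₂ _∧_ (e q) (f q)
        ; *-assoc = λ x y z q →
            ∧-assoc (lower (value x) q) (lower (value y) q) (lower (value z) q)
        ; *-identity =
              (λ x q → trans (∧-comm _ (lower (value x) q)) (min-identityʳ x q))
            , min-identityʳ
        ; distrib =
              (λ x y z q → ∧-distribˡ-∨ (lower (value x) q) (lower (value y) q) (lower (value z) q))
            , (λ x y z q → ∧-distribʳ-∨ (lower (value x) q) (lower (value y) q) (lower (value z) q))
        }
      ; zero = min-zeroˡ
             , λ x q → trans (∧-comm (lower (value x) q) _) (min-zeroˡ x q)
      }
    ; *-comm = λ x y q → ∧-comm (lower (value x) q) (lower (value y) q)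
    }
  }

module _ (em : ExcludedMiddle (lsuc 0ℓ)) (S : 𝕀 → Set₁) where

  private
    Below : ℚ → Set₁
    Below q = T ⌊ q ℚ.<? 0ℚ ⌋ ⊎ (∃[ x ] (S x × T (lower (value x) q)))

    below≤1 : ∀ q → Below q → T ⌊ q ℚ.<? 1ℚ ⌋
    below≤1 q (inj₁ t)           = ≤1 0𝕀 q t
    below≤1 q (inj₂ (x , _ , t)) = ≤1 x q t

  -- The supremum in [0,1]: the union of the cuts, with 0 adjoined so that the
  -- empty set has supremum 0.
  sup : 𝕀
  sup = mk𝕀
    (record
      { lower     = λ q → ⌊ em {Below q} ⌋
      ; inhabited = let (q , t) = inhabited (fromℚ 0ℚ) in q , fromWitness (inj₁ t)
      ; proper    = let (q , ¬q) = proper (fromℚ 1ℚ) in q , λ t → ¬q (below≤1 q (toWitness t))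
      ; closed    = λ {p} {q} p<q t → fromWitness (cl p<q (toWitness t))
      ; rounded   = λ t → let (r , q<r , u) = rd (toWitness t) in r , q<r , fromWitness u
      })
    (λ q t → fromWitness (inj₁ t))
    (λ q t → below≤1 q (toWitness t))
    where
    cl : ∀ {p q} → p ℚ.< q → Below q → Below p
    cl p<q (inj₁ t)           = inj₁ (closed (fromℚ 0ℚ) p<q t)
    cl p<q (inj₂ (x , s , t)) = inj₂ (x , s , closed (value x) p<q t)

    rd : ∀ {q} → Below q → ∃[ r ] (q ℚ.< r × Below r)
    rd (inj₁ t) = let (r , q<r , u) = rounded (fromℚ 0ℚ) t in r , q<r , inj₁ u
    rd (inj₂ (x , s , t)) =
      let (r , q<r , u) = rounded (value x) t in r , q<r , inj₂ (x , s , u)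

  sup-upper : ∀ x → S x → x ≤ sup
  sup-upper x s q t = fromWitness (inj₂ (x , s , t))

  sup-least : ∀ y → (∀ x → S x → x ≤ y) → sup ≤ y
  sup-least y ub q t with toWitness t
  ... | inj₁ u           = 0≤ y q u
  ... | inj₂ (x , s , u) = ub x s q u

------------------------------------------------------------------------
-- Syntax

-- Name sets are separate types, hence disjoint.
record Signature : Set₁ where
  field
    NC NR NI     : Set
    NC-countable : NC ↣ ℕ
    NR-countable : NR ↣ ℕ
    NI-countable : NI ↣ ℕ

open Signature public

infixr 6 _⊓_

data Role (S : Signature) : Set where
  name : NR S → Role S
  inv  : NR S → Role S

data Concept (S : Signature) : Set where
  atom  : NC S → Concept S
  some  : Role S → Concept S → Concept S
  _⊓_   : Concept S → Concept S → Concept S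
  top   : Concept S

data Basic (S : Signature) : Set where
  atom : NC S → Basic S
  some : Role S → Basic S

⌜_⌝ : ∀ {S} → Basic S → Concept S
⌜ atom A ⌝ = atom A
⌜ some P ⌝ = some P top

data Rhs (S : Signature) : Set where
  basic : Basic S → Rhs S
  bot   : Rhs S

infix 5 _⊑_ _⊑ʳ_ _⊓_⊑⊥

data Axiom (S : Signature) : Set where
  assertC : NC S → NI S → Axiom S
  assertR : NR S → NI S → NI S → Axiom S
  _⊑_     : Concept S → Rhs S → Axiom S
  _⊑ʳ_    : Role S → Role S → Axiom S
  _⊓_⊑⊥   : Role S → Role S → Axiom S

data Term (S : Signature) (k : ℕ) : Set where
  ind : NI S → Term S k
  var : Fin k → Term S k

data QueryAtom (S : Signature) (k : ℕ) : Set where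
  atomC : NC S → Term S k → QueryAtom S k
  atomR : NR S → Term S k → Term S k → QueryAtom S k

-- A list, because repeated atoms count separately in the annotated semantics.
record BCQ (S : Signature) : Set where
  constructor mkBCQ
  field
    vars  : ℕ
    atoms : List (QueryAtom S vars)

open BCQ public

data Formula (S : Signature) : Set where
  axiom : Axiom S → Formula S
  bcq   : BCQ S → Formula S

------------------------------------------------------------------------
-- Classical semantics

module _ {S : Signature} where

  record Interpretation : Set₁ where
    field
      Δ        : Set
      nonempty : Δ
      indᴵ     : NI S → Δ
      concᴵ    : NC S → Δ → Set
      roleᴵ    : NR S → Δ → Δ → Set

  module Classical (I : Interpretation) where
    open Interpretation I

    ⟦_⟧ʳ : Role S → Δ → Δ → Set
    ⟦ name R ⟧ʳ d e = roleᴵ R d e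
    ⟦ inv R ⟧ʳ  d e = roleᴵ R e d

    ⟦_⟧ᶜ : Concept S → Δ → Set
    ⟦ atom A ⟧ᶜ   d = concᴵ A d
    ⟦ some P C ⟧ᶜ d = ∃[ e ] (⟦ P ⟧ʳ d e × ⟦ C ⟧ᶜ e)
    ⟦ C ⊓ D ⟧ᶜ    d = ⟦ C ⟧ᶜ d × ⟦ D ⟧ᶜ d
    ⟦ top ⟧ᶜ      d = ⊤

    ⟦_⟧ᵈ : Rhs S → Δ → Set
    ⟦ basic B ⟧ᵈ d = ⟦ ⌜ B ⌝ ⟧ᶜ d
    ⟦ bot ⟧ᵈ     d = ⊥

    satAxiom : Axiom S → Set
    satAxiom (assertC A a)   = concᴵ A (indᴵ a)
    satAxiom (assertR R a b) = roleᴵ R (indᴵ a) (indᴵ b)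
    satAxiom (C ⊑ D)         = ∀ d → ⟦ C ⟧ᶜ d → ⟦ D ⟧ᵈ d
    satAxiom (P ⊑ʳ Q)        = ∀ d e → ⟦ P ⟧ʳ d e → ⟦ Q ⟧ʳ d e
    satAxiom (P ⊓ Q ⊑⊥)      = ∀ d e → ¬ (⟦ P ⟧ʳ d e × ⟦ Q ⟧ʳ d e)

    ⟦_⟧ᵗ : ∀ {k} → Term S k → (Fin k → Δ) → Δ
    ⟦ ind a ⟧ᵗ π = indᴵ a
    ⟦ var i ⟧ᵗ π = π i

    satAtom : ∀ {k} → (Fin k → Δ) → QueryAtom S k → Set
    satAtom π (atomC A t)   = concᴵ A (⟦ t ⟧ᵗ π)
    satAtom π (atomR R t u) = roleᴵ R (⟦ t ⟧ᵗ π) (⟦ u ⟧ᵗ π)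

    sat : Formula S → Set
    sat (axiom β) = satAxiom β
    sat (bcq q)   = Σ[ π ∈ (Fin (vars q) → Δ) ] All (satAtom π) (atoms q)

  IsModel : Interpretation → Pred (Axiom S) 0ℓ → Set
  IsModel I O = ∀ β → O β → Classical.satAxiom I β

  infix 4 _⊨_
  _⊨_ : Pred (Axiom S) 0ℓ → Formula S → Set₁
  O ⊨ α = (I : Interpretation) → IsModel I O → Classical.sat I α

  ConceptSat : Pred (Axiom S) 0ℓ → Concept S → Set₁
  ConceptSat O C = Σ[ I ∈ Interpretation ]
    (IsModel I O × (∃[ d ] Classical.⟦_⟧ᶜ I C d))

  RoleSat : Pred (Axiom S) 0ℓ → Role S → Set₁
  RoleSat O P = Σ[ I ∈ Interpretation ]
    (IsModel I O × (∃[ d ] ∃[ e ] Classical.⟦_⟧ʳ I P d e))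

  RoleConjSat : Pred (Axiom S) 0ℓ → Role S → Role S → Set₁
  RoleConjSat O P Q = Σ[ I ∈ Interpretation ]
    (IsModel I O ×
      (∃[ d ] ∃[ e ] (Classical.⟦_⟧ʳ I P d e × Classical.⟦_⟧ʳ I Q d e)))

------------------------------------------------------------------------
-- Annotated semantics

-- Only the values of `ann` on members of `axioms` matter: together they are a
-- finite set of axioms and a function from it to K ∖ {0}.
record AnnotatedOntology (S : Signature) (𝕂 : CommutativeSemiring 0ℓ 0ℓ) : Set where
  private module K = CommutativeSemiring 𝕂
  field
    axioms : List (Axiom S)
    ann    : Axiom S → K.Carrier
    ann≉0  : ∀ {β} → β ∈ axioms → ¬ (ann β K.≈ K.0#)

  axiomSet : Pred (Axiom S) 0ℓ
  axiomSet β = β ∈ axioms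

open AnnotatedOntology public

module _ {S : Signature} {𝕂 : CommutativeSemiring 0ℓ 0ℓ} where
  private module K = CommutativeSemiring 𝕂

  -- The semiring carries a setoid equality, so subsets of Δ × K are predicates
  -- that respect it.
  record AnnInterpretation : Set₁ where
    field
      Δ         : Set
      nonempty  : Δ
      indᴵ      : NI S → Δ
      concᴵ     : NC S → Δ → K.Carrier → Set
      roleᴵ     : NR S → Δ → Δ → K.Carrier → Set
      conc-resp : ∀ {A d κ κ′} → κ K.≈ κ′ → concᴵ A d κ → concᴵ A d κ′
      role-resp : ∀ {R d e κ κ′} → κ K.≈ κ′ → roleᴵ R d e κ → roleᴵ R d e κ′

  module Annotated (I : AnnInterpretation) where
    open AnnInterpretation I

    ⟦_⟧ʳ : Role S → Δ → Δ → K.Carrier → Set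
    ⟦ name R ⟧ʳ d e κ = roleᴵ R d e κ
    ⟦ inv R ⟧ʳ  d e κ = roleᴵ R e d κ

    ⟦_⟧ᶜ : Concept S → Δ → K.Carrier → Set
    ⟦ atom A ⟧ᶜ   d κ = concᴵ A d κ
    ⟦ some P C ⟧ᶜ d κ = ∃[ e ] ∃[ κ₁ ] ∃[ κ₂ ]
      (⟦ P ⟧ʳ d e κ₁ × ⟦ C ⟧ᶜ e κ₂ × κ K.≈ κ₁ K.* κ₂)
    ⟦ C ⊓ D ⟧ᶜ    d κ = ∃[ κ₁ ] ∃[ κ₂ ]
      (⟦ C ⟧ᶜ d κ₁ × ⟦ D ⟧ᶜ d κ₂ × κ K.≈ κ₁ K.* κ₂)
    ⟦ top ⟧ᶜ      d κ = κ K.≈ K.1#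

    ⟦_⟧ᵈ : Rhs S → Δ → K.Carrier → Set
    ⟦ basic B ⟧ᵈ d κ = ⟦ ⌜ B ⌝ ⟧ᶜ d κ
    ⟦ bot ⟧ᵈ     d κ = ⊥

    ⟦_⊓ʳ_⟧ : Role S → Role S → Δ → Δ → K.Carrier → Set
    ⟦ P ⊓ʳ Q ⟧ d e κ = ∃[ κ₁ ] ∃[ κ₂ ]
      (⟦ P ⟧ʳ d e κ₁ × ⟦ Q ⟧ʳ d e κ₂ × κ K.≈ κ₁ K.* κ₂)

    satAxiom : Axiom S → K.Carrier → Set
    satAxiom (assertC A a) κ   = concᴵ A (indᴵ a) κ
    satAxiom (assertR R a b) κ = roleᴵ R (indᴵ a) (indᴵ b) κ
    satAxiom (C ⊑ D) κ         = ∀ d κ′ → ⟦ C ⟧ᶜ d κ′ → ⟦ D ⟧ᵈ d (κ K.* κ′)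
    satAxiom (P ⊑ʳ Q) κ        = ∀ d e κ′ → ⟦ P ⟧ʳ d e κ′ → ⟦ Q ⟧ʳ d e (κ K.* κ′)
    satAxiom (P ⊓ Q ⊑⊥) κ      = ∀ d e κ′ → ¬ ⟦ P ⊓ʳ Q ⟧ d e κ′

    ⟦_⟧ᵗ : ∀ {k} → Term S k → (Fin k → Δ) → Δ
    ⟦ ind a ⟧ᵗ π = indᴵ a
    ⟦ var i ⟧ᵗ π = π i

    satAtom : ∀ {k} → (Fin k → Δ) → QueryAtom S k → K.Carrier → Set
    satAtom π (atomC A t) κ   = concᴵ A (⟦ t ⟧ᵗ π) κ
    satAtom π (atomR R t u) κ = roleᴵ R (⟦ t ⟧ᵗ π) (⟦ u ⟧ᵗ π) κ

    sat : Formula S → K.Carrier → Set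
    sat (axiom β) κ = satAxiom β κ
    sat (bcq q) κ   = Σ[ π ∈ (Fin (vars q) → Δ) ] ∃[ κs ]
      (Pointwise (satAtom π) (atoms q) κs × κ K.≈ foldr K._*_ K.1# κs)

  IsAnnModel : AnnInterpretation → AnnotatedOntology S 𝕂 → Set
  IsAnnModel I O = ∀ β → β ∈ axioms O → Annotated.satAxiom I β (ann O β)

  Satisfiable : AnnotatedOntology S 𝕂 → Set₁
  Satisfiable O = Σ[ I ∈ AnnInterpretation ] IsAnnModel I O

  infix 4 _⊨⟨_,_⟩
  _⊨⟨_,_⟩ : AnnotatedOntology S 𝕂 → Formula S → K.Carrier → Set₁
  O ⊨⟨ α , κ ⟩ = (I : AnnInterpretation) → IsAnnModel I O → Annotated.sat I α κ

------------------------------------------------------------------------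
-- Fuzzy provenance and cuts

module _ {S : Signature} where

  𝒫 : ExcludedMiddle (lsuc 0ℓ) → Formula S → AnnotatedOntology S 𝔽 → 𝕀
  𝒫 em α O = sup em (λ n′ → O ⊨⟨ α , n′ ⟩)

  cut : AnnotatedOntology S 𝔽 → 𝕀 → Pred (Axiom S) 0ℓ
  cut O n β = β ∈ axioms O × n ≤ ann O β

  -- ⊤, also when written redundantly as a conjunction such as ⊤ ⊓ ⊤.
  data IsTop : Concept S → Set where
    top : IsTop top
    _⊓_ : ∀ {C D} → IsTop C → IsTop D → IsTop (C ⊓ D)

  NoTopGCI : Pred (Axiom S) 0ℓ → Set
  NoTopGCI O = ∀ {C D} → O (C ⊑ D) → ¬ IsTop C

  data Case₁ (O : Pred (Axiom S) 0ℓ) : Formula S → Set₁ where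
    query   : ∀ {q} → Case₁ O (bcq q)
    assertC : ∀ {A a} → Case₁ O (axiom (assertC A a))
    assertR : ∀ {R a b} → Case₁ O (axiom (assertR R a b))
    posRI   : ∀ {P Q} → RoleSat O P → Case₁ O (axiom (P ⊑ʳ Q))
    negRI   : ∀ {P Q} → RoleConjSat O P Q → Case₁ O (axiom (P ⊓ Q ⊑⊥))

  data Case₂ (O : Pred (Axiom S) 0ℓ) : Formula S → Set₁ where
    basicGCI : ∀ {B B′} → ConceptSat O ⌜ B ⌝ → NoTopGCI O →
               Case₂ O (axiom (⌜ B ⌝ ⊑ basic B′))

-- A classical model J of the n-cut and a classical model M of O combine into
-- an annotated model on Δᴶ × Δᴹ: facts of M hold with every annotation ≤ m,
-- where m < n bounds the annotations outside the cut, and with all annotations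
-- if they also hold in J.  This refutes every annotation above m of a formula
-- that fails in J.
--
-- Conversely, keeping the facts annotated in a set closed under ⊗ turns
-- annotated models of O into classical models of the cut; here the set
-- consists of 1 and the finitely many annotations ≥ n.  If each of these
-- values κ had a model refuting (α , κ), the direct product of these models
-- would refute all of them at once.  For a GCI B ⊑ B′ the refuting points must
-- first satisfy B with annotation 1; this is achieved by passing to residuals
-- by the annotation of B, which is harmless in the absence of GCIs ⊤ ⊑ D.
-- An entailed RI is a chain of RIs of the cut.

module Submission where

open import Defs
open import Algebra.Bundles using (CommutativeSemiring)
import Algebra.Properties.CommutativeSemigroup as CommutativeSemigroupProperties
open import Axiom.ExcludedMiddle using (ExcludedMiddle)
open import Data.Bool using (Bool; true; false; T)
open import Data.Bool.Properties using (T?; T-∧)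
open import Data.Empty using (⊥; ⊥-elim)
open import Data.List using (List; []; _∷_; foldr; map; filter)
open import Data.List.Membership.Propositional using (_∈_)
open import Data.List.Membership.Propositional.Properties
  using (∈-map⁺; ∈-filter⁺; ∈-filter⁻)
import Data.List.Relation.Binary.Pointwise as PW
open import Data.List.Relation.Binary.Pointwise using (Pointwise; []; _∷_)
open import Data.List.Relation.Unary.All using (All; []; _∷_)
open import Data.List.Relation.Unary.Any using (here; there)
open import Data.Product using (∃-syntax; Σ-syntax; _×_; _,_; proj₁; proj₂)
import Data.Rational.Properties as ℚₚ
open import Data.Sum using (_⊎_; inj₁; inj₂; [_,_]′)
import Data.Sum as Sum
open import Data.Unit using (⊤; tt)
open import Function using (_⇔_; mk⇔; _∘_; id; Equivalence)
open import Level using (0ℓ; lift) renaming (suc to lsuc)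
open import Relation.Binary.Definitions using (tri<; tri≈; tri>)
open import Relation.Binary.PropositionalEquality as ≡ using (_≡_; subst)
open import Relation.Nullary using (¬_; yes; no)
open import Relation.Nullary.Decidable using (map′; decidable-stable)
open import Relation.Unary using (Pred)

-- Models of cuts, and annotations of roles and basic concepts

module _ {S : Signature} where

  cut⊆ : ∀ {I : Interpretation {S}} {O n} → IsModel I (axiomSet O) → IsModel I (cut O n)
  cut⊆ M β (β∈O , _) = M β β∈O

module _ {S : Signature} {𝕂 : CommutativeSemiring 0ℓ 0ℓ} where
  private
    module K = CommutativeSemiring 𝕂
    module K* = CommutativeSemigroupProperties K.*-commutativeSemigroup

    AnnInt : Set₁
    AnnInt = AnnInterpretation {S} {𝕂}

    variable
      κ κ′ κ″ : K.Carrier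

  module _ (I : AnnInt) where
    open AnnInterpretation I
    open Annotated I

    role-≈ : ∀ P {d e} → κ K.≈ κ′ → ⟦ P ⟧ʳ d e κ → ⟦ P ⟧ʳ d e κ′
    role-≈ (name R) = role-resp
    role-≈ (inv R)  = role-resp

    some-top⁺ : ∀ P {d} → ∃[ e ] ⟦ P ⟧ʳ d e κ → ⟦ some P top ⟧ᶜ d κ
    some-top⁺ P (e , p) = e , _ , K.1# , p , K.refl , K.sym (K.*-identityʳ _)

    -- ⊤ carries the annotation 1 only, so ∃P.⊤ has the annotation of a single edge.
    some-top⁻ : ∀ P {d} → ⟦ some P top ⟧ᶜ d κ → ∃[ e ] ⟦ P ⟧ʳ d e κ
    some-top⁻ P (e , κ₁ , κ₂ , p , κ₂≈1 , κ≈) =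
      e , role-≈ P (K.sym (K.trans κ≈ (K.trans (K.*-congˡ κ₂≈1) (K.*-identityʳ κ₁)))) p

    basic-≈ : ∀ B {d} → κ K.≈ κ′ → ⟦ ⌜ B ⌝ ⟧ᶜ d κ → ⟦ ⌜ B ⌝ ⟧ᶜ d κ′
    basic-≈ (atom A) eq = conc-resp eq
    basic-≈ (some P) eq (e , κ₁ , κ₂ , p , c , κ≈) =
      e , κ₁ , κ₂ , p , c , K.trans (K.sym eq) κ≈

  -- Classical thresholds of annotated interpretations

  module Threshold (Good : K.Carrier → Set)
    (good-≈ : ∀ {κ κ′} → κ K.≈ κ′ → Good κ → Good κ′)
    (good-1 : Good K.1#)
    (good-* : ∀ {κ κ′} → Good κ → Good κ′ → Good (κ K.* κ′))
    (I : AnnInt) where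

    private module I where
      open AnnInterpretation I public
      open Annotated I public

    -- `Good` may be any submonoid of the carrier under ⊗. The whole carrier yields a classical
    -- model of all axioms, the finite set of values at least n yields a model of the cut.
    threshold : Interpretation {S}
    threshold = record
      { Δ        = I.Δ
      ; nonempty = I.nonempty
      ; indᴵ     = I.indᴵ
      ; concᴵ    = λ A d → ∃[ κ ] (Good κ × I.concᴵ A d κ)
      ; roleᴵ    = λ R d e → ∃[ κ ] (Good κ × I.roleᴵ R d e κ)
      }

    open Classical threshold

    threshold-role⁺ : ∀ P {d e} → ∃[ κ ] (Good κ × I.⟦ P ⟧ʳ d e κ) → ⟦ P ⟧ʳ d e
    threshold-role⁺ (name R) p = p
    threshold-role⁺ (inv R)  p = p

    threshold-role⁻ : ∀ P {d e} → ⟦ P ⟧ʳ d e → ∃[ κ ] (Good κ × I.⟦ P ⟧ʳ d e κ)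
    threshold-role⁻ (name R) p = p
    threshold-role⁻ (inv R)  p = p

    threshold-concept⁻ : ∀ C {d} → ⟦ C ⟧ᶜ d → ∃[ κ ] (Good κ × I.⟦ C ⟧ᶜ d κ)
    threshold-concept⁻ (atom A) c = c
    threshold-concept⁻ (some P C) (e , p , c) =
      let (κ₁ , g₁ , p′) = threshold-role⁻ P p
          (κ₂ , g₂ , c′) = threshold-concept⁻ C c
      in κ₁ K.* κ₂ , good-* g₁ g₂ , e , κ₁ , κ₂ , p′ , c′ , K.refl
    threshold-concept⁻ (C ⊓ D) (c , d) =
      let (κ₁ , g₁ , c′) = threshold-concept⁻ C c
          (κ₂ , g₂ , d′) = threshold-concept⁻ D d
      in κ₁ K.* κ₂ , good-* g₁ g₂ , κ₁ , κ₂ , c′ , d′ , K.refl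
    threshold-concept⁻ top c = K.1# , good-1 , K.refl

    -- A good annotation of ∃P.⊤ is a good annotation of an edge. In deeper concepts a good product
    -- may have factors that are not good; right-hand sides of GCIs are basic or ⊥, so this case
    -- suffices.
    threshold-basic⁺ : ∀ B {d} → Good κ → I.⟦ ⌜ B ⌝ ⟧ᶜ d κ → ⟦ ⌜ B ⌝ ⟧ᶜ d
    threshold-basic⁺ (atom A) g b = _ , g , b
    threshold-basic⁺ (some P) g b =
      let (e , p) = some-top⁻ I P b in e , threshold-role⁺ P (_ , g , p) , tt

    threshold-sat : ∀ β → Good κ → I.satAxiom β κ → satAxiom β
    threshold-sat (assertC A a) g s = _ , g , s
    threshold-sat (assertR R a b) g s = _ , g , s
    threshold-sat (C ⊑ basic B) g s d c =
      let (_ , g′ , c′) = threshold-concept⁻ C c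
      in threshold-basic⁺ B (good-* g g′) (s d _ c′)
    threshold-sat (C ⊑ bot) g s d c =
      let (_ , _ , c′) = threshold-concept⁻ C c in s d _ c′
    threshold-sat (P ⊑ʳ Q) g s d e p =
      let (_ , g′ , p′) = threshold-role⁻ P p
      in threshold-role⁺ Q (_ , good-* g g′ , s d e _ p′)
    threshold-sat (P ⊓ Q ⊑⊥) g s d e (p , q) =
      let (κ₁ , _ , p′) = threshold-role⁻ P p
          (κ₂ , _ , q′) = threshold-role⁻ Q q
      in s d e _ (κ₁ , κ₂ , p′ , q′ , K.refl)

    threshold-term : ∀ {k} (t : Term S k) π → ⟦ t ⟧ᵗ π ≡ I.⟦ t ⟧ᵗ π
    threshold-term (ind a) π = ≡.refl
    threshold-term (var i) π = ≡.refl

    threshold-atom : ∀ {k π} (x : QueryAtom S k) → satAtom π x → ∃[ κ ] (Good κ × I.satAtom π x κ)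
    threshold-atom {π = π} (atomC A t) s rewrite threshold-term t π = s
    threshold-atom {π = π} (atomR R t u) s
      rewrite threshold-term t π | threshold-term u π = s

    threshold-query : ∀ q → sat (bcq q) → ∃[ κ ] (Good κ × I.sat (bcq q) κ)
    threshold-query q (π , ss) =
      let (κs , g , ss′) = go ss in _ , g , π , κs , ss′ , K.refl
      where
      go : ∀ {xs} → All (satAtom π) xs →
           ∃[ κs ] (Good (foldr K._*_ K.1# κs) × Pointwise (I.satAtom π) xs κs)
      go [] = [] , good-1 , []
      go (_∷_ {x = x} s ss) =
        let (κ , g , s′)   = threshold-atom {π = π} x s
            (κs , h , ss′) = go ss
        in κ ∷ κs , good-* g h , s′ ∷ ss′

  -- Counting every annotation as good forgets the annotations. The result serves as the second
  -- component of an amalgam when the formula brings no model of its own.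
  support-model : {O : AnnotatedOntology S 𝕂} → Satisfiable O →
                  Σ[ M ∈ Interpretation {S} ] IsModel M (axiomSet O)
  support-model (I , I⊨O) = threshold , λ β β∈O → threshold-sat β tt (I⊨O β β∈O)
    where open Threshold (λ _ → ⊤) (λ _ _ → tt) tt (λ _ _ → tt) I

  -- Amalgams of two classical interpretations

  module Amalgam (Low : K.Carrier → Set)
    (low-≈ : ∀ {κ κ′} → κ K.≈ κ′ → Low κ → Low κ′)
    (low-*ˡ : ∀ {κ κ′} → Low κ → Low (κ K.* κ′))
    (low-prime : ∀ {κ κ′} → Low (κ K.* κ′) → Low κ ⊎ Low κ′)
    (J M : Interpretation {S}) where

    private
      module J where
        open Interpretation J public
        open Classical J public
      module M where
        open Interpretation M public
        open Classical M public

      low-*ʳ : Low κ′ → Low (κ K.* κ′)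
      low-*ʳ l = low-≈ (K.*-comm _ _) (low-*ˡ l)

      -- One low factor makes a product low; if no factor is found to be low, both parts hold in J.
      low-*-⊎ : ∀ {A B : Set} → κ K.≈ κ′ K.* κ″ → Low κ′ ⊎ A → Low κ″ ⊎ B → Low κ ⊎ (A × B)
      low-*-⊎ eq (inj₁ l) _ = inj₁ (low-≈ (K.sym eq) (low-*ˡ l))
      low-*-⊎ eq (inj₂ a) (inj₁ l) = inj₁ (low-≈ (K.sym eq) (low-*ʳ l))
      low-*-⊎ eq (inj₂ a) (inj₂ b) = inj₂ (a , b)

    amalgam : AnnInt
    amalgam = record
      { Δ         = J.Δ × M.Δ
      ; nonempty  = J.nonempty , M.nonempty
      ; indᴵ      = λ a → J.indᴵ a , M.indᴵ a
      ; concᴵ     = λ A (x , y) κ → M.concᴵ A y × (Low κ ⊎ J.concᴵ A x)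
      ; roleᴵ     = λ R (x , y) (x′ , y′) κ → M.roleᴵ R y y′ × (Low κ ⊎ J.roleᴵ R x x′)
      ; conc-resp = λ eq (m , s) → m , Sum.map₁ (low-≈ eq) s
      ; role-resp = λ eq (m , s) → m , Sum.map₁ (low-≈ eq) s
      }

    open Annotated amalgam

    amalgam-role⁺ : ∀ P {x y x′ y′} → M.⟦ P ⟧ʳ y y′ → Low κ ⊎ J.⟦ P ⟧ʳ x x′ →
                    ⟦ P ⟧ʳ (x , y) (x′ , y′) κ
    amalgam-role⁺ (name R) m s = m , s
    amalgam-role⁺ (inv R)  m s = m , s

    amalgam-role⁻ : ∀ P {x y x′ y′} → ⟦ P ⟧ʳ (x , y) (x′ , y′) κ →
                    M.⟦ P ⟧ʳ y y′ × (Low κ ⊎ J.⟦ P ⟧ʳ x x′)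
    amalgam-role⁻ (name R) p = p
    amalgam-role⁻ (inv R)  p = p

    amalgam-concept⁻ : ∀ C {x y} → ⟦ C ⟧ᶜ (x , y) κ → M.⟦ C ⟧ᶜ y × (Low κ ⊎ J.⟦ C ⟧ᶜ x)
    amalgam-concept⁻ (atom A) c = c
    amalgam-concept⁻ (some P C) ((x′ , y′) , _ , _ , p , c , eq) =
      let (m , s)   = amalgam-role⁻ P p
          (m′ , s′) = amalgam-concept⁻ C c
      in (y′ , m , m′) , Sum.map₂ (x′ ,_) (low-*-⊎ eq s s′)
    amalgam-concept⁻ (C ⊓ D) (_ , _ , c , d , eq) =
      let (m , s)   = amalgam-concept⁻ C c
          (m′ , s′) = amalgam-concept⁻ D d
      in (m , m′) , low-*-⊎ eq s s′
    amalgam-concept⁻ top c = tt , inj₂ tt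

    amalgam-basic⁺ : ∀ B {x y} → M.⟦ ⌜ B ⌝ ⟧ᶜ y → Low κ ⊎ J.⟦ ⌜ B ⌝ ⟧ᶜ x →
                     ⟦ ⌜ B ⌝ ⟧ᶜ (x , y) κ
    amalgam-basic⁺ (atom A) m s = m , s
    -- A low edge demands nothing of J, so the J-component of the successor is arbitrary; x is at
    -- hand.
    amalgam-basic⁺ (some P) {x} (y′ , m , _) (inj₁ l) =
      some-top⁺ amalgam P ((x , y′) , amalgam-role⁺ P m (inj₁ l))
    amalgam-basic⁺ (some P) (y′ , m , _) (inj₂ (x′ , j , _)) =
      some-top⁺ amalgam P (_ , amalgam-role⁺ P m (inj₂ j))

    private
      apply : ∀ {A B : Set} → Low κ ⊎ (A → B) → Low κ′ ⊎ A → Low (κ K.* κ′) ⊎ B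
      apply (inj₁ l) _        = inj₁ (low-*ˡ l)
      apply (inj₂ f) (inj₁ l) = inj₁ (low-*ʳ l)
      apply (inj₂ f) (inj₂ a) = inj₂ (f a)

    -- An axiom with a low annotation yields low conclusions, which only have to hold in M. A
    -- violation of a ⊥-axiom projects to a violation in M.
    amalgam-sat : ∀ β → M.satAxiom β → Low κ ⊎ J.satAxiom β → satAxiom β κ
    amalgam-sat (assertC A a) m s = m , s
    amalgam-sat (assertR R a b) m s = m , s
    amalgam-sat (C ⊑ basic B) m s (x , y) _ c =
      let (m′ , s′) = amalgam-concept⁻ C c
      in amalgam-basic⁺ B (m y m′) (apply (Sum.map₂ (λ f → f x) s) s′)
    amalgam-sat (C ⊑ bot) m s (x , y) _ c = m y (proj₁ (amalgam-concept⁻ C c))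
    amalgam-sat (P ⊑ʳ Q) m s (x , y) (x′ , y′) _ p =
      let (m′ , s′) = amalgam-role⁻ P p
      in amalgam-role⁺ Q (m y y′ m′) (apply (Sum.map₂ (λ f → f x x′) s) s′)
    amalgam-sat (P ⊓ Q ⊑⊥) m s (x , y) (x′ , y′) _ (_ , _ , p , q , _) =
      m y y′ (proj₁ (amalgam-role⁻ P p) , proj₁ (amalgam-role⁻ Q q))

    amalgam-term : ∀ {k} (t : Term S k) π → proj₁ (⟦ t ⟧ᵗ π) ≡ J.⟦ t ⟧ᵗ (proj₁ ∘ π)
    amalgam-term (ind a) π = ≡.refl
    amalgam-term (var i) π = ≡.refl

    amalgam-atom : ∀ {k π} (x : QueryAtom S k) → satAtom π x κ → Low κ ⊎ J.satAtom (proj₁ ∘ π) x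
    amalgam-atom {π = π} (atomC A t) (_ , s) rewrite amalgam-term t π = s
    amalgam-atom {π = π} (atomR R t u) (_ , s)
      rewrite amalgam-term t π | amalgam-term u π = s

    amalgam-query : ∀ q → sat (bcq q) κ → Low κ ⊎ J.sat (bcq q)
    amalgam-query q (π , κs , ss , eq) =
      Sum.map (low-≈ (K.sym eq)) (proj₁ ∘ π ,_) (go ss)
      where
      go : ∀ {xs κs} → Pointwise (satAtom π) xs κs →
           Low (foldr K._*_ K.1# κs) ⊎ All (J.satAtom (proj₁ ∘ π)) xs
      go [] = inj₂ []
      go (_∷_ {x = x} s ss) =
        Sum.map₂ (λ (s , ss) → s ∷ ss) (low-*-⊎ K.refl (amalgam-atom {π = π} x s) (go ss))

    -- A P-edge of J paired with a P-edge of M has annotation 1. The resulting Q-edge has annotation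
    -- κ, which is not low, so it comes from J. Without a P-edge in M the amalgam would have none
    -- either, and the inclusion would hold vacuously.
    amalgam-RI : ∀ P Q → ¬ Low κ → (∃[ y ] ∃[ y′ ] M.⟦ P ⟧ʳ y y′) →
                 satAxiom (P ⊑ʳ Q) κ → J.satAxiom (P ⊑ʳ Q)
    amalgam-RI P Q ¬l (y , y′ , m) s x x′ j
      with amalgam-role⁻ Q (s (x , y) (x′ , y′) K.1# (amalgam-role⁺ P m (inj₂ j)))
    ... | _ , inj₁ l  = ⊥-elim (¬l (low-≈ (K.*-identityʳ _) l))
    ... | _ , inj₂ j′ = j′

    amalgam-GCI : ∀ B B′ → ¬ Low κ → (∃[ y ] M.⟦ ⌜ B ⌝ ⟧ᶜ y) →
                  satAxiom (⌜ B ⌝ ⊑ basic B′) κ → J.satAxiom (⌜ B ⌝ ⊑ basic B′)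
    amalgam-GCI B B′ ¬l (y , m) s x j
      with amalgam-concept⁻ ⌜ B′ ⌝ (s (x , y) K.1# (amalgam-basic⁺ B m (inj₂ j)))
    ... | _ , inj₁ l  = ⊥-elim (¬l (low-≈ (K.*-identityʳ _) l))
    ... | _ , inj₂ j′ = j′

  -- Direct products

  module Product (I J : AnnInt) where
    private
      module I where
        open AnnInterpretation I public
        open Annotated I public
      module J where
        open AnnInterpretation J public
        open Annotated J public

    -- A fact receives the annotations common to both components, so an annotation refuted in one
    -- component stays refuted.
    product : AnnInt
    product = record
      { Δ         = I.Δ × J.Δ
      ; nonempty  = I.nonempty , J.nonempty
      ; indᴵ      = λ a → I.indᴵ a , J.indᴵ a
      ; concᴵ     = λ A (x , y) κ → I.concᴵ A x κ × J.concᴵ A y κ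
      ; roleᴵ     = λ R (x , y) (x′ , y′) κ → I.roleᴵ R x x′ κ × J.roleᴵ R y y′ κ
      ; conc-resp = λ eq (i , j) → I.conc-resp eq i , J.conc-resp eq j
      ; role-resp = λ eq (i , j) → I.role-resp eq i , J.role-resp eq j
      }

    open Annotated product

    product-role⁺ : ∀ P {x y x′ y′} → I.⟦ P ⟧ʳ x x′ κ → J.⟦ P ⟧ʳ y y′ κ →
                    ⟦ P ⟧ʳ (x , y) (x′ , y′) κ
    product-role⁺ (name R) p q = p , q
    product-role⁺ (inv R)  p q = p , q

    product-role⁻ : ∀ P {x y x′ y′} → ⟦ P ⟧ʳ (x , y) (x′ , y′) κ →
                    I.⟦ P ⟧ʳ x x′ κ × J.⟦ P ⟧ʳ y y′ κ
    product-role⁻ (name R) p = p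
    product-role⁻ (inv R)  p = p

    product-concept⁻ : ∀ C {x y} → ⟦ C ⟧ᶜ (x , y) κ → I.⟦ C ⟧ᶜ x κ × J.⟦ C ⟧ᶜ y κ
    product-concept⁻ (atom A) c = c
    product-concept⁻ (some P C) ((x′ , y′) , κ₁ , κ₂ , p , c , eq) =
      let (p₁ , p₂) = product-role⁻ P p
          (c₁ , c₂) = product-concept⁻ C c
      in (x′ , κ₁ , κ₂ , p₁ , c₁ , eq) , (y′ , κ₁ , κ₂ , p₂ , c₂ , eq)
    product-concept⁻ (C ⊓ D) (κ₁ , κ₂ , c , d , eq) =
      let (c₁ , c₂) = product-concept⁻ C c
          (d₁ , d₂) = product-concept⁻ D d
      in (κ₁ , κ₂ , c₁ , d₁ , eq) , (κ₁ , κ₂ , c₂ , d₂ , eq)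
    product-concept⁻ top c = c , c

    -- Only one edge is involved in ∃P.⊤. For compound concepts the two components might split κ
    -- into different factors.
    product-basic⁺ : ∀ B {x y} → I.⟦ ⌜ B ⌝ ⟧ᶜ x κ → J.⟦ ⌜ B ⌝ ⟧ᶜ y κ → ⟦ ⌜ B ⌝ ⟧ᶜ (x , y) κ
    product-basic⁺ (atom A) c d = c , d
    product-basic⁺ (some P) c d =
      let (x′ , p) = some-top⁻ I P c
          (y′ , q) = some-top⁻ J P d
      in some-top⁺ product P ((x′ , y′) , product-role⁺ P p q)

    product-sat : ∀ β → I.satAxiom β κ → J.satAxiom β κ → satAxiom β κ
    product-sat (assertC A a) s t = s , t
    product-sat (assertR R a b) s t = s , t
    product-sat (C ⊑ basic B) s t (x , y) _ c =
      let (c₁ , c₂) = product-concept⁻ C c in product-basic⁺ B (s x _ c₁) (t y _ c₂)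
    product-sat (C ⊑ bot) s t (x , y) _ c = s x _ (proj₁ (product-concept⁻ C c))
    product-sat (P ⊑ʳ Q) s t (x , y) (x′ , y′) _ p =
      let (p₁ , p₂) = product-role⁻ P p in product-role⁺ Q (s x x′ _ p₁) (t y y′ _ p₂)
    product-sat (P ⊓ Q ⊑⊥) s t (x , y) (x′ , y′) _ (κ₁ , κ₂ , p , q , eq) =
      s x x′ _ (κ₁ , κ₂ , proj₁ (product-role⁻ P p) , proj₁ (product-role⁻ Q q) , eq)

    product-model : {O : AnnotatedOntology S 𝕂} →
                    IsAnnModel I O → IsAnnModel J O → IsAnnModel product O
    product-model I⊨O J⊨O β β∈O = product-sat β (I⊨O β β∈O) (J⊨O β β∈O)

    product-term₁ : ∀ {k} (t : Term S k) π → proj₁ (⟦ t ⟧ᵗ π) ≡ I.⟦ t ⟧ᵗ (proj₁ ∘ π)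
    product-term₁ (ind a) π = ≡.refl
    product-term₁ (var i) π = ≡.refl

    product-term₂ : ∀ {k} (t : Term S k) π → proj₂ (⟦ t ⟧ᵗ π) ≡ J.⟦ t ⟧ᵗ (proj₂ ∘ π)
    product-term₂ (ind a) π = ≡.refl
    product-term₂ (var i) π = ≡.refl

    product-atom⁻ : ∀ {k π} (x : QueryAtom S k) → satAtom π x κ →
                    I.satAtom (proj₁ ∘ π) x κ × J.satAtom (proj₂ ∘ π) x κ
    product-atom⁻ {π = π} (atomC A t) s
      rewrite product-term₁ t π | product-term₂ t π = s
    product-atom⁻ {π = π} (atomR R t u) s
      rewrite product-term₁ t π | product-term₂ t π
            | product-term₁ u π | product-term₂ u π = s

    product-query⁻ : ∀ q → sat (bcq q) κ → I.sat (bcq q) κ × J.sat (bcq q) κ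
    product-query⁻ q (π , κs , ss , eq) =
        (proj₁ ∘ π , κs , PW.map (λ {x} → proj₁ ∘ product-atom⁻ {π = π} x) ss , eq)
      , (proj₂ ∘ π , κs , PW.map (λ {x} → proj₂ ∘ product-atom⁻ {π = π} x) ss , eq)

  -- Residuals

  -- The residual by ε lives on the first summand; the second one is a copy of
  -- I that keeps the assertions true.
  module Residual (ε : K.Carrier) (idem : ε K.* ε K.≈ ε) (I : AnnInt) where
    private module I where
      open AnnInterpretation I public
      open Annotated I public

    _⊎ʳ_ : (I.Δ → I.Δ → K.Carrier → Set) → (I.Δ → I.Δ → K.Carrier → Set) →
           I.Δ ⊎ I.Δ → I.Δ ⊎ I.Δ → K.Carrier → Set
    (U ⊎ʳ V) (inj₁ x) (inj₁ y) = U x y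
    (U ⊎ʳ V) (inj₂ x) (inj₂ y) = V x y
    (U ⊎ʳ V) (inj₁ x) (inj₂ y) = λ _ → ⊥
    (U ⊎ʳ V) (inj₂ x) (inj₁ y) = λ _ → ⊥

    relax : (I.Δ → I.Δ → K.Carrier → Set) → I.Δ ⊎ I.Δ → I.Δ ⊎ I.Δ → K.Carrier → Set
    relax U = (λ x y μ → U x y (ε K.* μ)) ⊎ʳ U

    relax-≈ : ∀ U → (∀ {x y κ κ′} → κ K.≈ κ′ → U x y κ → U x y κ′) →
              ∀ u v → κ K.≈ κ′ → relax U u v κ → relax U u v κ′
    relax-≈ U r (inj₁ x) (inj₁ y) eq = r (K.*-congˡ eq)
    relax-≈ U r (inj₂ x) (inj₂ y) eq = r eq

    residual : AnnInt
    residual = record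
      { Δ         = I.Δ ⊎ I.Δ
      ; nonempty  = inj₂ I.nonempty
      ; indᴵ      = inj₂ ∘ I.indᴵ
      ; concᴵ     = λ A u μ → [ (λ x → I.concᴵ A x (ε K.* μ)) , (λ x → I.concᴵ A x μ) ]′ u
      ; roleᴵ     = λ R → relax (I.roleᴵ R)
      ; conc-resp = λ { {d = inj₁ x} eq → I.conc-resp (K.*-congˡ eq)
                      ; {d = inj₂ x} eq → I.conc-resp eq }
      ; role-resp = λ {R} {u} {v} → relax-≈ (I.roleᴵ R) I.role-resp u v
      }

    open Annotated residual

    private
      ε-left : κ K.≈ κ′ K.* κ″ → ε K.* κ K.≈ (ε K.* κ′) K.* κ″
      ε-left eq = K.trans (K.*-congˡ eq) (K.sym (K.*-assoc ε _ _))

      ε-right : κ K.≈ κ′ K.* κ″ → ε K.* κ K.≈ κ′ K.* (ε K.* κ″)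
      ε-right eq = K.trans (K.*-congˡ eq) (K*.x∙yz≈y∙xz ε _ _)

      ε-both : κ K.≈ κ′ K.* κ″ → ε K.* κ K.≈ (ε K.* κ′) K.* (ε K.* κ″)
      ε-both eq = K.trans (K.*-cong (K.sym idem) eq) (K*.interchange ε ε _ _)

    residual-role⁺ : ∀ P u v → relax I.⟦ P ⟧ʳ u v κ → ⟦ P ⟧ʳ u v κ
    residual-role⁺ (name R) u v p = p
    residual-role⁺ (inv R) (inj₁ x) (inj₁ y) p = p
    residual-role⁺ (inv R) (inj₂ x) (inj₂ y) p = p

    residual-role⁻ : ∀ P u v → ⟦ P ⟧ʳ u v κ → relax I.⟦ P ⟧ʳ u v κ
    residual-role⁻ (name R) u v p = p
    residual-role⁻ (inv R) (inj₁ x) (inj₁ y) p = p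
    residual-role⁻ (inv R) (inj₂ x) (inj₂ y) p = p

    residual-conceptʳ : ∀ C {x} → ⟦ C ⟧ᶜ (inj₂ x) κ → I.⟦ C ⟧ᶜ x κ
    residual-conceptʳ (atom A) c = c
    residual-conceptʳ (some P C) (v , κ₁ , κ₂ , p , c , eq)
      with v | residual-role⁻ P _ v p
    ... | inj₂ y | p′ = y , κ₁ , κ₂ , p′ , residual-conceptʳ C c , eq
    residual-conceptʳ (C ⊓ D) (κ₁ , κ₂ , c , d , eq) =
      κ₁ , κ₂ , residual-conceptʳ C c , residual-conceptʳ D d , eq
    residual-conceptʳ top c = c

    -- Every atom and every edge contributes a factor ε, and idempotence merges these factors into
    -- one. Only ⊤ contributes none, which gives rise to the second alternative.
    residual-conceptˡ : ∀ C {x} → ⟦ C ⟧ᶜ (inj₁ x) κ →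
                        I.⟦ C ⟧ᶜ x (ε K.* κ) ⊎ (IsTop C × I.⟦ C ⟧ᶜ x κ)
    residual-conceptˡ (atom A) c = inj₁ c
    residual-conceptˡ (some P C) (v , κ₁ , κ₂ , p , c , eq)
      with v | residual-role⁻ P _ v p
    ... | inj₁ y | p′ with residual-conceptˡ C c
    ...   | inj₁ c′ = inj₁ (y , _ , _ , p′ , c′ , ε-both eq)
    ...   | inj₂ (_ , c′) = inj₁ (y , _ , _ , p′ , c′ , ε-left eq)
    residual-conceptˡ (C ⊓ D) (κ₁ , κ₂ , c , d , eq)
      with residual-conceptˡ C c | residual-conceptˡ D d
    ... | inj₁ c′       | inj₁ d′       = inj₁ (_ , _ , c′ , d′ , ε-both eq)
    ... | inj₁ c′       | inj₂ (_ , d′) = inj₁ (_ , _ , c′ , d′ , ε-left eq)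
    ... | inj₂ (_ , c′) | inj₁ d′       = inj₁ (_ , _ , c′ , d′ , ε-right eq)
    ... | inj₂ (t , c′) | inj₂ (u , d′) = inj₂ (t ⊓ u , κ₁ , κ₂ , c′ , d′ , eq)
    residual-conceptˡ top c = inj₂ (top , c)

    -- For κ = 1 this is the purpose of the residual: where B has annotation ε in I, it gets
    -- annotation 1.
    residual-basicˡ⁺ : ∀ B {x} → I.⟦ ⌜ B ⌝ ⟧ᶜ x (ε K.* κ) → ⟦ ⌜ B ⌝ ⟧ᶜ (inj₁ x) κ
    residual-basicˡ⁺ (atom A) b = b
    residual-basicˡ⁺ (some P) b =
      let (y , p) = some-top⁻ I P b
      in some-top⁺ residual P (inj₁ y , residual-role⁺ P _ (inj₁ y) p)

    residual-basicˡ⁻ : ∀ B {x} → ⟦ ⌜ B ⌝ ⟧ᶜ (inj₁ x) κ → I.⟦ ⌜ B ⌝ ⟧ᶜ x (ε K.* κ)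
    residual-basicˡ⁻ (atom A) b = b
    residual-basicˡ⁻ (some P) b = [ id , (λ ()) ]′ (residual-conceptˡ (some P top) b)

    residual-basicʳ⁺ : ∀ B {x} → I.⟦ ⌜ B ⌝ ⟧ᶜ x κ → ⟦ ⌜ B ⌝ ⟧ᶜ (inj₂ x) κ
    residual-basicʳ⁺ (atom A) b = b
    residual-basicʳ⁺ (some P) b =
      let (y , p) = some-top⁻ I P b
      in some-top⁺ residual P (inj₂ y , residual-role⁺ P _ (inj₂ y) p)

    -- The factor ε moves past the annotation of the axiom by commutativity. From ⊤ ⊑ D, however, I
    -- only yields D with κ ⊗ κ′, whereas the left summand asks for the additional factor ε.
    residual-sat : ∀ β → (∀ {C D} → β ≡ (C ⊑ D) → ¬ IsTop C) →
                   I.satAxiom β κ → satAxiom β κ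
    residual-sat (assertC A a) _ s = s
    residual-sat (assertR R a b) _ s = s
    residual-sat (C ⊑ basic B) nt s (inj₁ x) _ c =
      [ (λ c′ → residual-basicˡ⁺ B (basic-≈ I B (K*.x∙yz≈y∙xz _ ε _) (s x _ c′)))
      , (λ (t , _) → ⊥-elim (nt ≡.refl t)) ]′ (residual-conceptˡ C c)
    residual-sat (C ⊑ basic B) nt s (inj₂ x) _ c =
      residual-basicʳ⁺ B (s x _ (residual-conceptʳ C c))
    residual-sat (C ⊑ bot) nt s (inj₁ x) _ c =
      [ s x _ , (λ (_ , c′) → s x _ c′) ]′ (residual-conceptˡ C c)
    residual-sat (C ⊑ bot) nt s (inj₂ x) _ c = s x _ (residual-conceptʳ C c)
    residual-sat {κ} (P ⊑ʳ Q) _ s u v κ′ p = residual-role⁺ Q u v (go u v (residual-role⁻ P u v p))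
      where
      go : ∀ u v → relax I.⟦ P ⟧ʳ u v κ′ → relax I.⟦ Q ⟧ʳ u v (κ K.* κ′)
      go (inj₁ x) (inj₁ y) p = role-≈ I Q (K*.x∙yz≈y∙xz _ ε _) (s x y _ p)
      go (inj₂ x) (inj₂ y) p = s x y _ p
    residual-sat (P ⊓ Q ⊑⊥) _ s u v _ (_ , _ , p , q , _) =
      go u v (residual-role⁻ P u v p) (residual-role⁻ Q u v q)
      where
      go : ∀ u v → relax I.⟦ P ⟧ʳ u v κ → ¬ relax I.⟦ Q ⟧ʳ u v κ′
      go (inj₁ x) (inj₁ y) p q = s x y _ (_ , _ , p , q , K.refl)
      go (inj₂ x) (inj₂ y) p q = s x y _ (_ , _ , p , q , K.refl)

    residual-model : {O : AnnotatedOntology S 𝕂} → NoTopGCI (axiomSet O) →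
                     IsAnnModel I O → IsAnnModel residual O
    residual-model nt I⊨O β β∈O =
      residual-sat β (λ { ≡.refl → nt β∈O }) (I⊨O β β∈O)

-- Chains of role inclusions

module RoleChains {S : Signature} where

  _⁻ : Role S → Role S
  name R ⁻ = inv R
  inv R ⁻  = name R

  -- An inclusion also holds between the inverses of its two sides, hence two ways to prolong a
  -- chain.
  data Chain (O : Pred (Axiom S) 0ℓ) (P : Role S) : Role S → Set where
    []   : Chain O P P
    _∷_  : ∀ {Q Q′} → O (Q ⊑ʳ Q′) → Chain O P Q → Chain O P Q′
    _∷⁻_ : ∀ {Q Q′} → O (Q ⊑ʳ Q′) → Chain O P (Q ⁻) → Chain O P (Q′ ⁻)

  module _ (O : Pred (Axiom S) 0ℓ) (P : Role S) (J : Interpretation {S}) (J⊨O : IsModel J O) where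
    private module J where
      open Interpretation J public
      open Classical J public

    inverse⁺ : ∀ Q {x y} → J.⟦ Q ⟧ʳ x y → J.⟦ Q ⁻ ⟧ʳ y x
    inverse⁺ (name R) p = p
    inverse⁺ (inv R)  p = p

    inverse⁻ : ∀ Q {x y} → J.⟦ Q ⁻ ⟧ʳ y x → J.⟦ Q ⟧ʳ x y
    inverse⁻ (name R) p = p
    inverse⁻ (inv R)  p = p

    chain-sound : ∀ {Q x y} → Chain O P Q → J.⟦ P ⟧ʳ x y → J.⟦ Q ⟧ʳ x y
    chain-sound []       p = p
    chain-sound (o ∷ c)  p = J⊨O _ o _ _ (chain-sound c p)
    chain-sound (_∷⁻_ {Q} {Q′} o c) p =
      inverse⁺ Q′ (J⊨O _ o _ _ (inverse⁻ Q (chain-sound c p)))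

    -- Two copies of J; an edge from the first to the second copy only
    -- satisfies the roles that a chain derives from P.
    role² : Role S → Bool × J.Δ → Bool × J.Δ → Set
    role² Q (false , x) (false , y) = J.⟦ Q ⟧ʳ x y
    role² Q (true  , x) (true  , y) = J.⟦ Q ⟧ʳ x y
    role² Q (false , x) (true  , y) = Chain O P Q × J.⟦ P ⟧ʳ x y
    role² Q (true  , x) (false , y) = Chain O P (Q ⁻) × J.⟦ P ⟧ʳ y x

    twoCopies : Interpretation {S}
    twoCopies = record
      { Δ        = Bool × J.Δ
      ; nonempty = false , J.nonempty
      ; indᴵ     = λ a → false , J.indᴵ a
      ; concᴵ    = λ A (_ , x) → J.concᴵ A x
      ; roleᴵ    = λ R → role² (name R)
      }

    open Classical twoCopies

    twoCopies-role⁺ : ∀ Q u v → role² Q u v → ⟦ Q ⟧ʳ u v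
    twoCopies-role⁺ (name R) u v p = p
    twoCopies-role⁺ (inv R) (false , x) (false , y) p = p
    twoCopies-role⁺ (inv R) (false , x) (true  , y) p = p
    twoCopies-role⁺ (inv R) (true  , x) (false , y) p = p
    twoCopies-role⁺ (inv R) (true  , x) (true  , y) p = p

    twoCopies-role⁻ : ∀ Q u v → ⟦ Q ⟧ʳ u v → role² Q u v
    twoCopies-role⁻ (name R) u v p = p
    twoCopies-role⁻ (inv R) (false , x) (false , y) p = p
    twoCopies-role⁻ (inv R) (false , x) (true  , y) p = p
    twoCopies-role⁻ (inv R) (true  , x) (false , y) p = p
    twoCopies-role⁻ (inv R) (true  , x) (true  , y) p = p

    role²-project : ∀ Q u v → role² Q u v → J.⟦ Q ⟧ʳ (proj₂ u) (proj₂ v)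
    role²-project Q (false , x) (false , y) p = p
    role²-project Q (true  , x) (true  , y) p = p
    role²-project Q (false , x) (true  , y) (c , p) = chain-sound c p
    role²-project Q (true  , x) (false , y) (c , p) = inverse⁻ Q (chain-sound c p)

    twoCopies-role : ∀ Q u v → ⟦ Q ⟧ʳ u v → J.⟦ Q ⟧ʳ (proj₂ u) (proj₂ v)
    twoCopies-role Q u v = role²-project Q u v ∘ twoCopies-role⁻ Q u v

    twoCopies-concept : ∀ C u → ⟦ C ⟧ᶜ u → J.⟦ C ⟧ᶜ (proj₂ u)
    twoCopies-concept (atom A) u c = c
    twoCopies-concept (some Q C) u (v , p , c) =
      proj₂ v , twoCopies-role Q u v p , twoCopies-concept C v c
    twoCopies-concept (C ⊓ D) u (c , d) = twoCopies-concept C u c , twoCopies-concept D u d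
    twoCopies-concept top u c = tt

    -- Successors are taken inside the same copy, so existential right-hand sides never call for an
    -- edge between the copies.
    twoCopies-basic : ∀ B u → J.⟦ ⌜ B ⌝ ⟧ᶜ (proj₂ u) → ⟦ ⌜ B ⌝ ⟧ᶜ u
    twoCopies-basic (atom A) u b = b
    twoCopies-basic (some Q) (false , x) (y , p , _) =
      (false , y) , twoCopies-role⁺ Q (false , x) (false , y) p , tt
    twoCopies-basic (some Q) (true , x) (y , p , _) =
      (true , y) , twoCopies-role⁺ Q (true , x) (true , y) p , tt

    -- The projection to J is a homomorphism, which settles GCIs and negative inclusions. Edges
    -- between the copies respect positive inclusions because chains can be prolonged, backward
    -- edges by `_∷⁻_`.
    twoCopies-model : IsModel twoCopies O
    twoCopies-model (assertC A a) o = J⊨O _ o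
    twoCopies-model (assertR R a b) o = J⊨O _ o
    twoCopies-model (C ⊑ basic B) o u c =
      twoCopies-basic B u (J⊨O _ o _ (twoCopies-concept C u c))
    twoCopies-model (C ⊑ bot) o u c = J⊨O _ o _ (twoCopies-concept C u c)
    twoCopies-model (Q ⊑ʳ Q′) o u v = twoCopies-role⁺ Q′ u v ∘ go u v ∘ twoCopies-role⁻ Q u v
      where
      go : ∀ u v → role² Q u v → role² Q′ u v
      go (false , x) (false , y) p = J⊨O _ o x y p
      go (true  , x) (true  , y) p = J⊨O _ o x y p
      go (false , x) (true  , y) (c , p) = o ∷ c , p
      go (true  , x) (false , y) (c , p) = o ∷⁻ c , p
    twoCopies-model (Q ⊓ Q′ ⊑⊥) o u v (p , q) =
      J⊨O _ o _ _ (twoCopies-role Q u v p , twoCopies-role Q′ u v q)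

  -- The edge between the two copies over a P-edge satisfies P by the empty chain. It must satisfy Q
  -- as well, and there this means that a chain leads to Q.
  chain-complete : ∀ {O P Q} → RoleSat O P → O ⊨ axiom (P ⊑ʳ Q) → Chain O P Q
  chain-complete {O} {P} {Q} (J , J⊨O , x , y , p) O⊨α =
    proj₁ (twoCopies-role⁻ O P J J⊨O Q u v
      (O⊨α (twoCopies O P J J⊨O) (twoCopies-model O P J J⊨O) u v
        (twoCopies-role⁺ O P J J⊨O P u v ([] , p))))
    where
    u = false , x
    v = true , y

-- The order on [0,1]

≤-trans : ∀ x y z → x ≤ y → y ≤ z → x ≤ z
≤-trans x y z f g q t = g q (f q t)

≈⇒≤ : ∀ x y → x ≈ y → x ≤ y
≈⇒≤ x y eq q = subst T (eq q)

≤-antisym : ∀ x y → x ≤ y → y ≤ x → x ≈ y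
≤-antisym x y f g q = T-injective (f q) (g q)
  where
  T-injective : ∀ {a b} → (T a → T b) → (T b → T a) → a ≡ b
  T-injective {false} {false} _ _ = ≡.refl
  T-injective {true}  {true}  _ _ = ≡.refl
  T-injective {false} {true}  _ g = ⊥-elim (g tt)
  T-injective {true}  {false} f _ = ⊥-elim (f tt)

min-≤ˡ : ∀ x y → min x y ≤ x
min-≤ˡ x y q t = proj₁ (Equivalence.to T-∧ t)

min-greatest : ∀ x y z → z ≤ x → z ≤ y → z ≤ min x y
min-greatest x y z f g q t = Equivalence.from T-∧ (f q t , g q t)

x≤y⇒min≈x : ∀ x y → x ≤ y → min x y ≈ x
x≤y⇒min≈x x y x≤y =
  ≤-antisym (min x y) x (min-≤ˡ x y) (min-greatest x y x (λ _ t → t) x≤y)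

module 𝔽 = CommutativeSemiring 𝔽

-- Linearity of [0,1], gaps and suprema, by excluded middle

module Classically (em : ExcludedMiddle (lsuc 0ℓ)) where

  em₀ : ExcludedMiddle 0ℓ
  em₀ = map′ (λ (lift p) → p) lift em

  ≤-total : ∀ x y → x ≤ y ⊎ y ≤ x
  ≤-total x y with em₀ {x ≤ y}
  ... | yes x≤y = inj₁ x≤y
  ... | no  x≰y = inj₂ λ r r∈y → decidable-stable (T? _) λ r∉x → x≰y (above r∈y r∉x)
    where
    -- Here r bounds the lower cut of x, and all rationals below r belong to y.
    above : ∀ {r} → T (lower (value y) r) → ¬ T (lower (value x) r) → x ≤ y
    above {r} r∈y r∉x q q∈x with ℚₚ.<-cmp q r
    ... | tri< q<r _ _ = closed (value y) q<r r∈y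
    ... | tri≈ _ ≡.refl _ = r∈y
    ... | tri> _ _ r<q = ⊥-elim (r∉x (closed (value x) r<q q∈x))

  min-selective : ∀ x y → min x y ≈ x ⊎ min x y ≈ y
  min-selective x y =
    Sum.map (x≤y⇒min≈x x y)
            (λ y≤x → 𝔽.trans {min x y} {min y x} {y} (𝔽.*-comm x y) (x≤y⇒min≈x y x y≤x))
      (≤-total x y)

  min-prime : ∀ x y m → min x y ≤ m → x ≤ m ⊎ y ≤ m
  min-prime x y m l =
    Sum.map (λ e → ≤-trans x (min x y) m (≈⇒≤ x (min x y) (𝔽.sym {min x y} {x} e)) l)
            (λ e → ≤-trans y (min x y) m (≈⇒≤ y (min x y) (𝔽.sym {min x y} {y} e)) l)
      (min-selective x y)

  -- The bound m is the largest among 0 and the finitely many values f x with n ≰ f x. Since 0 is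
  -- included, n must not be 0.
  below-gap : ∀ {A : Set} (f : A → 𝕀) n → ¬ n ≤ 0𝕀 → (xs : List A) →
              ∃[ m ] (¬ n ≤ m × (∀ {x} → x ∈ xs → n ≤ f x ⊎ f x ≤ m))
  below-gap f n n≰0 [] = 0𝕀 , n≰0 , λ ()
  below-gap f n n≰0 (y ∷ ys) with below-gap f n n≰0 ys | em₀ {n ≤ f y}
  ... | m , n≰m , h | yes n≤y =
    m , n≰m , λ { (here ≡.refl) → inj₁ n≤y ; (there i) → h i }
  ... | m , n≰m , h | no n≰y with ≤-total (f y) m
  ...   | inj₁ y≤m = m , n≰m , λ { (here ≡.refl) → inj₂ y≤m ; (there i) → h i }
  ...   | inj₂ m≤y = f y , n≰y , λ
    { (here ≡.refl) → inj₂ (λ _ t → t)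
    ; (there i) → Sum.map₂ (λ x≤m q t → m≤y q (x≤m q t)) (h i) }

  -- Otherwise m would bound X. As a supremum need not be attained, an element exceeding m has to
  -- stand in for one that reaches n.
  sup-exceeds : ∀ (X : 𝕀 → Set₁) n m → ¬ n ≤ m → n ≤ sup em X → ∃[ κ ] (X κ × ¬ κ ≤ m)
  sup-exceeds X n m n≰m n≤sup with em {∃[ κ ] (X κ × ¬ κ ≤ m)}
  ... | yes found = found
  ... | no none = ⊥-elim (n≰m (≤-trans n (sup em X) m n≤sup
    (sup-least em X m λ κ x → decidable-stable em₀ λ κ≰m → none (κ , x , κ≰m))))

  module Cut {S : Signature} (O : AnnotatedOntology S 𝔽) (n : 𝕀) where

    entailed⇒≤𝒫 : ∀ α κ → n ≤ κ → O ⊨⟨ α , κ ⟩ → n ≤ 𝒫 em α O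
    entailed⇒≤𝒫 α κ n≤κ O⊨α =
      ≤-trans n κ (𝒫 em α O) n≤κ (sup-upper em (λ κ → O ⊨⟨ α , κ ⟩) κ O⊨α)

    -- From the provenance value to entailment by the cut

    module _ (n≉0 : ¬ n ≈ 0𝕀) where

      private
        gap = below-gap (ann O) n (λ n≤0 → n≉0 (≤-antisym n 0𝕀 n≤0 (0≤ n))) (axioms O)
        m   = proj₁ gap

      module A = Amalgam {S} {𝔽} (_≤ m)
        (λ {κ} {κ′} eq l → ≤-trans κ′ κ m (≈⇒≤ κ′ κ (𝔽.sym {κ} {κ′} eq)) l)
        (λ {κ} {κ′} l → ≤-trans (min κ κ′) κ m (min-≤ˡ κ κ′) l)
        (λ {κ} {κ′} → min-prime κ κ′ m)

      amalgam-model : ∀ {J M} → IsModel J (cut O n) → IsModel M (axiomSet O) →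
                      IsAnnModel (A.amalgam J M) O
      amalgam-model {J} {M} J⊨cut M⊨O β β∈O =
        A.amalgam-sat J M β (M⊨O β β∈O)
          ([ (λ n≤β → inj₂ (J⊨cut β (β∈O , n≤β))) , inj₁ ]′ (proj₂ (proj₂ gap) β∈O))

      ≤𝒫⇒cut : Satisfiable O → ∀ α → Case₁ (axiomSet O) α ⊎ Case₂ (axiomSet O) α →
                n ≤ 𝒫 em α O → cut O n ⊨ α
      ≤𝒫⇒cut O-sat α case n≤𝒫 J J⊨cut
        with sup-exceeds (λ κ → O ⊨⟨ α , κ ⟩) n m (proj₁ (proj₂ gap)) n≤𝒫
      ... | κ , O⊨α , κ≰m = go α case O⊨α
        where
        support = support-model {S} {𝔽} {O} O-sat
        M₀ = proj₁ support
        M₀⊨O = proj₂ support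

        go : ∀ α → Case₁ (axiomSet O) α ⊎ Case₂ (axiomSet O) α → O ⊨⟨ α , κ ⟩ →
             Classical.sat J α
        go (bcq q) (inj₁ query) O⊨α =
          [ (λ l → ⊥-elim (κ≰m l)) , id ]′
            (A.amalgam-query J M₀ {κ} q (O⊨α (A.amalgam J M₀) (amalgam-model J⊨cut M₀⊨O)))
        go _ (inj₁ assertC) O⊨α =
          [ (λ l → ⊥-elim (κ≰m l)) , id ]′
            (proj₂ (O⊨α (A.amalgam J M₀) (amalgam-model J⊨cut M₀⊨O)))
        go _ (inj₁ assertR) O⊨α =
          [ (λ l → ⊥-elim (κ≰m l)) , id ]′
            (proj₂ (O⊨α (A.amalgam J M₀) (amalgam-model J⊨cut M₀⊨O)))
        go (axiom (P ⊑ʳ Q)) (inj₁ (posRI (M , M⊨O , p))) O⊨α =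
          A.amalgam-RI J M {κ} P Q κ≰m p (O⊨α (A.amalgam J M) (amalgam-model J⊨cut M⊨O))
        go (axiom (P ⊓ Q ⊑⊥)) (inj₁ (negRI (M , M⊨O , y , y′ , p , q))) O⊨α =
          -- Over any point of J, the pair of M that violates the inclusion carries the low
          -- annotation m for both roles.
          ⊥-elim (O⊨α (A.amalgam J M) (amalgam-model J⊨cut M⊨O) (x , y) (x , y′) (min m m)
            ( m , m , A.amalgam-role⁺ J M P p (inj₁ λ _ t → t)
            , A.amalgam-role⁺ J M Q q (inj₁ λ _ t → t) , λ _ → ≡.refl))
          where x = Interpretation.nonempty J
        go _ (inj₂ (basicGCI {B} {B′} (M , M⊨O , b) _)) O⊨α =
          A.amalgam-GCI J M {κ} B B′ κ≰m b (O⊨α (A.amalgam J M) (amalgam-model J⊨cut M⊨O))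

    -- Entailment from the cut

    private
      values : List 𝕀
      values = filter (λ x → em₀ {n ≤ x}) (1𝕀 ∷ map (ann O) (axioms O))

    Good : 𝕀 → Set
    Good κ = ∃[ v ] (v ∈ values × κ ≈ v)

    good-≈ : ∀ κ κ′ → κ ≈ κ′ → Good κ → Good κ′
    good-≈ κ κ′ eq (v , i , e) = v , i , 𝔽.trans {κ′} {κ} {v} (𝔽.sym {κ} {κ′} eq) e

    1∈values : 1𝕀 ∈ values
    1∈values = ∈-filter⁺ (λ x → em₀ {n ≤ x}) (here ≡.refl) (≤1 n)

    good-1 : Good 1𝕀
    good-1 = 1𝕀 , 1∈values , λ _ → ≡.refl

    -- The minimum is one of its arguments, so a finite set of values is closed under it.
    good-min : ∀ κ κ′ → Good κ → Good κ′ → Good (min κ κ′)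
    good-min κ κ′ g g′ =
      [ (λ e → good-≈ κ (min κ κ′) (𝔽.sym {min κ κ′} {κ} e) g)
      , (λ e → good-≈ κ′ (min κ κ′) (𝔽.sym {min κ κ′} {κ′} e) g′) ]′ (min-selective κ κ′)

    good-cut : ∀ {β} → cut O n β → Good (ann O β)
    good-cut (β∈O , n≤β) =
      _ , ∈-filter⁺ (λ x → em₀ {n ≤ x}) (there (∈-map⁺ (ann O) β∈O)) n≤β , λ _ → ≡.refl

    module Th = Threshold {S} {𝔽} Good
      (λ {κ} {κ′} → good-≈ κ κ′) good-1 (λ {κ} {κ′} → good-min κ κ′)

    threshold-cut : ∀ {I} → IsAnnModel I O → IsModel (Th.threshold I) (cut O n)
    threshold-cut {I} I⊨O β (β∈O , n≤β) =
      Th.threshold-sat I β (good-cut (β∈O , n≤β)) (I⊨O β β∈O)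

    private
      AnnInt : Set₁
      AnnInt = AnnInterpretation {S} {𝔽}

    -- In `hit` the value may vary with the model; finitely many values and closure under products
    -- make it uniform. `Point` is the extra data carried by a model: nothing for queries and
    -- assertions, a point satisfying B with annotation 1 for a GCI.
    uniform-value :
      (Point : AnnInt → Set) (Goal : ∀ I → Point I → 𝕀 → Set) →
      (∀ I p κ κ′ → κ ≈ κ′ → Goal I p κ → Goal I p κ′) →
      (pair : ∀ {I J} → Point I → Point J → Point (Product.product I J)) →
      (∀ {I J} p q κ → Goal (Product.product I J) (pair p q) κ → Goal I p κ × Goal J q κ) →
      (∀ I p → IsAnnModel I O → ∃[ κ ] (Good κ × Goal I p κ)) →
      ∃[ κ ] (n ≤ κ × (∀ I p → IsAnnModel I O → Goal I p κ))
    uniform-value Point Goal goal-≈ pair goal-pair hit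
      with em {∃[ κ ] (κ ∈ values × (∀ I p → IsAnnModel I O → Goal I p κ))}
    ... | yes (κ , i , h) = κ , proj₂ (∈-filter⁻ (λ x → em₀ {n ≤ x}) i) , h
    ... | no none = ⊥-elim contradiction
      where
      Refutes : (𝕀 → Set) → Set₁
      Refutes X = Σ[ I ∈ AnnInt ] Σ[ p ∈ Point I ] (IsAnnModel I O × (∀ κ → X κ → ¬ Goal I p κ))

      refute : ∀ {κ} → κ ∈ values → Refutes (_≡ κ)
      refute {κ} i = decidable-stable em λ ¬r →
        none (κ , i , λ I p I⊨O → decidable-stable em₀ λ ¬g →
          ¬r (I , p , I⊨O , λ { _ ≡.refl → ¬g }))

      refute-all : ∀ vs → (∀ {κ} → κ ∈ vs → κ ∈ values) → Refutes (_∈ vs)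
      refute-all [] _ =
        -- Even with nothing left to refute a model with a point is required; the one refuting the
        -- value 1 is taken.
        let (I , p , I⊨O , _) = refute 1∈values in I , p , I⊨O , λ _ ()
      refute-all (v ∷ vs) sub =
        let (I , p , I⊨O , f) = refute (sub (here ≡.refl))
            (J , q , J⊨O , g) = refute-all vs (sub ∘ there)
        in Product.product I J , pair p q , Product.product-model I J {O} I⊨O J⊨O , λ
          { κ (here eq) → f κ eq ∘ proj₁ ∘ goal-pair p q κ
          ; κ (there i) → g κ i ∘ proj₂ ∘ goal-pair p q κ }

      contradiction : ⊥
      contradiction =
        let (I , p , I⊨O , f)   = refute-all values id
            (κ , (v , i , e) , g) = hit I p I⊨O
        in f v i (goal-≈ I p κ v e g)

    open RoleChains {S}

    -- The value κ is the minimum of the annotations along the chain, starting from 1 for the empty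
    -- chain.
    chain-entailed : ∀ {P Q} → Chain (cut O n) P Q →
                     ∃[ κ ] (n ≤ κ × O ⊨⟨ axiom (P ⊑ʳ Q) , κ ⟩)
    chain-entailed {P} [] = 1𝕀 , ≤1 n , λ I _ d e κ p →
      role-≈ I P (𝔽.sym {min 1𝕀 κ} {κ} (𝔽.*-identityˡ κ)) p
    chain-entailed (_∷_ {Q} {Q′} (o , n≤λ) c) =
      let (κ , n≤κ , O⊨) = chain-entailed c
          λβ = ann O (Q ⊑ʳ Q′)
      in min λβ κ , min-greatest λβ κ n n≤λ n≤κ , λ I I⊨O d e κ′ p →
        role-≈ I Q′ (𝔽.sym {min (min λβ κ) κ′} {min λβ (min κ κ′)} (𝔽.*-assoc λβ κ κ′))
          (I⊨O _ o d e _ (O⊨ I I⊨O d e κ′ p))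
    chain-entailed (_∷⁻_ {Q} {Q′} (o , n≤λ) c) =
      let (κ , n≤κ , O⊨) = chain-entailed c
          λβ = ann O (Q ⊑ʳ Q′)
      in min λβ κ , min-greatest λβ κ n n≤λ n≤κ , λ I I⊨O d e κ′ p →
        ann-inverse⁺ I Q′
          (role-≈ I Q′ (𝔽.sym {min (min λβ κ) κ′} {min λβ (min κ κ′)} (𝔽.*-assoc λβ κ κ′))
            (I⊨O _ o e d _ (ann-inverse⁻ I Q (O⊨ I I⊨O d e κ′ p))))
      where
      ann-inverse⁺ : ∀ (I : AnnInt) Q {x y κ} → Annotated.⟦_⟧ʳ I Q x y κ → Annotated.⟦_⟧ʳ I (Q ⁻) y x κ
      ann-inverse⁺ I (name R) p = p
      ann-inverse⁺ I (inv R)  p = p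

      ann-inverse⁻ : ∀ (I : AnnInt) Q {x y κ} → Annotated.⟦_⟧ʳ I (Q ⁻) y x κ → Annotated.⟦_⟧ʳ I Q x y κ
      ann-inverse⁻ I (name R) p = p
      ann-inverse⁻ I (inv R)  p = p

    cut⇒≤𝒫 : ∀ α → Case₁ (axiomSet O) α ⊎ Case₂ (axiomSet O) α →
              cut O n ⊨ α → n ≤ 𝒫 em α O
    cut⇒≤𝒫 (bcq q) (inj₁ query) cut⊨α =
      let (κ , n≤κ , h) = uniform-value (λ _ → ⊤) (λ I _ → Annotated.sat I (bcq q))
            (λ { I _ κ κ′ eq (π , κs , ss , e) →
                   π , κs , ss , 𝔽.trans {κ′} {κ} {foldr min 1𝕀 κs} (𝔽.sym {κ} {κ′} eq) e })
            (λ _ _ → tt)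
            (λ {I} {J} _ _ κ → Product.product-query⁻ I J {κ} q)
            (λ I _ I⊨O → Th.threshold-query I q (cut⊨α (Th.threshold I) (threshold-cut I⊨O)))
      in entailed⇒≤𝒫 (bcq q) κ n≤κ λ I → h I tt
    cut⇒≤𝒫 α@(axiom (assertC A a)) (inj₁ assertC) cut⊨α =
      let (κ , n≤κ , h) = uniform-value (λ _ → ⊤) (λ I _ → Annotated.sat I α)
            (λ I _ κ κ′ → AnnInterpretation.conc-resp I {κ = κ} {κ′})
            (λ _ _ → tt)
            (λ _ _ κ s → s)
            (λ I _ I⊨O → cut⊨α (Th.threshold I) (threshold-cut I⊨O))
      in entailed⇒≤𝒫 α κ n≤κ λ I → h I tt
    cut⇒≤𝒫 α@(axiom (assertR R a b)) (inj₁ assertR) cut⊨α =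
      let (κ , n≤κ , h) = uniform-value (λ _ → ⊤) (λ I _ → Annotated.sat I α)
            (λ I _ κ κ′ → AnnInterpretation.role-resp I {κ = κ} {κ′})
            (λ _ _ → tt)
            (λ _ _ κ s → s)
            (λ I _ I⊨O → cut⊨α (Th.threshold I) (threshold-cut I⊨O))
      in entailed⇒≤𝒫 α κ n≤κ λ I → h I tt
    cut⇒≤𝒫 α@(axiom (P ⊑ʳ Q)) (inj₁ (posRI (M , M⊨O , p))) cut⊨α =
      let (κ , n≤κ , O⊨α) = chain-entailed (chain-complete {cut O n} {P} {Q}
                              (M , cut⊆ {I = M} {O} {n} M⊨O , p) cut⊨α)
      in entailed⇒≤𝒫 α κ n≤κ O⊨α
    cut⇒≤𝒫 (axiom (P ⊓ Q ⊑⊥)) (inj₁ (negRI (M , M⊨O , y , y′ , p))) cut⊨α =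
      ⊥-elim (cut⊨α M (cut⊆ {I = M} {O} {n} M⊨O) y y′ p)
    cut⇒≤𝒫 α (inj₂ (basicGCI {B} {B′} _ noTop)) cut⊨α =
      let (κ , n≤κ , h) = uniform-value
            -- With the fixed annotation 1, B persists at paired points of products and, 1 being
            -- good, in thresholds.
            (λ I → ∃[ d ] Annotated.⟦_⟧ᶜ I ⌜ B ⌝ d 1𝕀)
            (λ I (d , _) → Annotated.⟦_⟧ᶜ I ⌜ B′ ⌝ d)
            (λ I _ κ κ′ → basic-≈ I {κ} {κ′} B′)
            (λ {I} {J} (d , b) (e , c) → (d , e) , Product.product-basic⁺ I J B b c)
            (λ {I} {J} _ _ κ → Product.product-concept⁻ I J ⌜ B′ ⌝)
            (λ I (d , b) I⊨O → Th.threshold-concept⁻ I ⌜ B′ ⌝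
              (cut⊨α (Th.threshold I) (threshold-cut I⊨O) d (Th.threshold-basic⁺ I B good-1 b)))
      in entailed⇒≤𝒫 (axiom (⌜ B ⌝ ⊑ basic B′)) κ n≤κ λ I I⊨O d ε b →
        -- For an arbitrary annotation ε of B at d, the left copy of d in the residual satisfies B
        -- with 1. There B′ holds with κ, which in I means with ε ⊗ κ.
        let module R = Residual ε (x≤y⇒min≈x ε ε (λ _ t → t)) I
            ε≈ε1 = 𝔽.sym {min ε 1𝕀} {ε} (𝔽.*-identityʳ ε)
        in basic-≈ I {min ε κ} {min κ ε} B′ (𝔽.*-comm ε κ)
          (R.residual-basicˡ⁻ B′
            (h R.residual (inj₁ d , R.residual-basicˡ⁺ B (basic-≈ I {ε} {min ε 1𝕀} B ε≈ε1 b))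
              (R.residual-model {O} noTop I⊨O)))

proposition3p15 : (em : ExcludedMiddle (lsuc 0ℓ))
    (S : Signature)
    (O : AnnotatedOntology S 𝔽) → Satisfiable O →
    (n : 𝕀) → ¬ (n ≈ 0𝕀) →
    (α : Formula S) → Case₁ (axiomSet O) α ⊎ Case₂ (axiomSet O) α →
    (n ≤ 𝒫 em α O) ⇔ (cut O n ⊨ α)
proposition3p15 em S O O-sat n n≉0 α case = mk⇔ (≤𝒫⇒cut n≉0 O-sat α case) (cut⇒≤𝒫 α case)
  where
  open Classically em
  open Cut O n
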